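{- Let $G=(V,E)$ be an undirected graph and $\mu$ an orientation of its edges. Let $\mathcal D$ be an AD paths decomposition of $(G,\mu)$ with degree at most 1. Coloring each path in $\mathcal D$ using two alternating colors yields an oriented degree-splitting $(E_1,E_2)$ of $(G,\mu)$ with discrepancy at most 1.
   Context: A path here is a trail $P=(v_0,e_1,v_1,\dots,e_k,v_k)$ (a walk with pairwise distinct edges, vertices may repeat; if $v_0=v_k$ it is called a cycle). $P$ is an alternating-directions (AD) path if for every $1\le i<k$, the edges $e_i,e_{i+1}$ are either both oriented (under $\mu$) towards $v_i$ or both oriented away from $v_i$. $v_0$ is an incoming endpoint of $P$ if $e_1$ is oriented towards $v_0$, and an outgoing endpoint otherwise; symmetrically $v_k$ is an incoming endpoint if $e_k$ is oriented towards $v_k$, and an outgoing endpoint otherwise. An AD paths decomposition of $(G,\mu)$ with degree at most $\kappa$ is a partition of $E$ into edge-disjoint AD paths such that each vertex is an incoming endpoint of at most $\kappa$ of these paths and an outgoing endpoint of at most $\kappa$ of these paths. Coloring a path with two alternating colors means consecutive edges $e_i,e_{i+1}$ of the path receive opposite colors (one of two colors). An oriented degree-splitting with discrepancy $\kappa$ is a partition $(E_1,E_2)$ of $E$ such that for every vertex $v$, the numbers of incoming edges at $v$ in $E_1$ and in $E_2$ differ by at most $\kappa$, and the numbers of outgoing edges at $v$ in $E_1$ and in $E_2$ differ by at most $\kappa$. -}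

module Defs where

open import Data.Bool using (Bool)
import Data.Bool.Properties as Bool
open import Data.Fin using (Fin; zero; suc; inject₁; fromℕ; _≟_)
open import Data.Fin.Subset using (Subset; _∈_; _∪_; _∩_; ⊤; ⊥)
open import Data.Fin.Subset.Properties using (_∈?_)
open import Data.List using (length; filter; allFin)
open import Data.Nat using (ℕ; suc; _≤_; ∣_-_∣)
open import Data.Product using (∃; _×_; _,_; proj₁; proj₂)
open import Data.Sum using (_⊎_)
open import Data.Vec using (tabulate)
open import Function.Definitions using (Injective)
open import Relation.Binary.PropositionalEquality using (_≡_; _≢_)
open import Relation.Nullary using (¬_; Dec; does; ¬?; _×-dec_; _⊎-dec_)
open import Relation.Unary using (Pred; Decidable)

count : ∀ {n p} {P : Pred (Fin n) p} → Decidable P → ℕ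
count {n} P? = length (filter P? (allFin n))

-- A finite loopless graph.  The order of the pair `ends e` carries no meaning:
-- it is only ever used through `Joins`.  Parallel edges are not excluded; a
-- simple graph is the case where distinct edges have distinct end sets.
record Graph : Set where
  field
    #V #E    : ℕ
    ends     : Fin #E → Fin #V × Fin #V
    loopless : ∀ e → proj₁ (ends e) ≢ proj₂ (ends e)

  V E : Set
  V = Fin #V
  E = Fin #E

  Joins : E → V → V → Set
  Joins e u v = ends e ≡ (u , v) ⊎ ends e ≡ (v , u)

record Orientation (G : Graph) : Set where
  open Graph G
  field
    tail head : E → V
    orients   : ∀ e → Joins e (tail e) (head e)

  Towards Away : E → V → Set
  Towards e v = head e ≡ v
  Away    e v = tail e ≡ v

  towards? : ∀ e v → Dec (Towards e v)
  towards? e v = head e ≟ v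

  away? : ∀ e v → Dec (Away e v)
  away? e v = tail e ≟ v

-- A trail (v₀, e₁, v₁, …, e_k, v_k) with k = suc k-1 ≥ 1; `vertex i` is v_i
-- and `edge i` is e_{i+1}.  Vertices may repeat, and v₀ = v_k is allowed.
record Path (G : Graph) : Set where
  open Graph G
  field
    k-1      : ℕ
    vertex   : Fin (suc (suc k-1)) → V
    edge     : Fin (suc k-1) → E
    joins    : ∀ i → Joins (edge i) (vertex (inject₁ i)) (vertex (suc i))
    distinct : Injective _≡_ _≡_ edge

  firstVertex lastVertex : V
  firstVertex = vertex zero
  lastVertex  = vertex (fromℕ (suc k-1))

  firstEdge lastEdge : E
  firstEdge = edge zero
  lastEdge  = edge (fromℕ k-1)

  Contains : E → Set
  Contains e = ∃ λ i → edge i ≡ e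

module _ {G : Graph} (μ : Orientation G) where
  open Graph G
  open Orientation μ

  -- The index i stands for the inner vertex v_{i+1}, between e_{i+1} and e_{i+2}.
  IsAD : Path G → Set
  IsAD P = ∀ (i : Fin k-1) → let v = vertex (suc (inject₁ i)) in
      (Towards (edge (inject₁ i)) v × Towards (edge (suc i)) v)
    ⊎ (Away    (edge (inject₁ i)) v × Away    (edge (suc i)) v)
    where open Path P

  IncomingEndpoint OutgoingEndpoint : V → Path G → Set
  IncomingEndpoint v P =
      (firstVertex ≡ v × Towards firstEdge firstVertex)
    ⊎ (lastVertex  ≡ v × Towards lastEdge  lastVertex)
    where open Path P
  OutgoingEndpoint v P =
      (firstVertex ≡ v × ¬ Towards firstEdge firstVertex)
    ⊎ (lastVertex  ≡ v × ¬ Towards lastEdge  lastVertex)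
    where open Path P

  incomingEndpoint? : ∀ v → Decidable (IncomingEndpoint v)
  incomingEndpoint? v P =
      ((firstVertex ≟ v) ×-dec towards? firstEdge firstVertex)
    ⊎-dec ((lastVertex ≟ v) ×-dec towards? lastEdge lastVertex)
    where open Path P

  outgoingEndpoint? : ∀ v → Decidable (OutgoingEndpoint v)
  outgoingEndpoint? v P =
      ((firstVertex ≟ v) ×-dec ¬? (towards? firstEdge firstVertex))
    ⊎-dec ((lastVertex ≟ v) ×-dec ¬? (towards? lastEdge lastVertex))
    where open Path P

  -- The degree bounds count paths, so a closed path both of whose ends are
  -- incoming at v contributes 1 at v.
  record ADPathsDecomposition (κ : ℕ) : Set where
    field
      #paths     : ℕ
      path       : Fin #paths → Path G
      isAD       : ∀ a → IsAD (path a)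
      covers     : ∀ e → ∃ λ a → Path.Contains (path a) e
      disjoint   : ∀ a b e → Path.Contains (path a) e → Path.Contains (path b) e → a ≡ b
      incoming≤κ : ∀ v → count (λ a → incomingEndpoint? v (path a)) ≤ κ
      outgoing≤κ : ∀ v → count (λ a → outgoingEndpoint? v (path a)) ≤ κ

  inDegree outDegree : Subset #E → V → ℕ
  inDegree  F v = count (λ e → (e ∈? F) ×-dec towards? e v)
  outDegree F v = count (λ e → (e ∈? F) ×-dec away? e v)

  record IsOrientedDegreeSplitting (κ : ℕ) (E₁ E₂ : Subset #E) : Set where
    field
      exhaustive     : E₁ ∪ E₂ ≡ ⊤
      disjoint       : E₁ ∩ E₂ ≡ ⊥
      inDiscrepancy  : ∀ v → ∣ inDegree  E₁ v - inDegree  E₂ v ∣ ≤ κ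
      outDiscrepancy : ∀ v → ∣ outDegree E₁ v - outDegree E₂ v ∣ ≤ κ

AlternatesOn : {G : Graph} → (Graph.E G → Bool) → Path G → Set
AlternatesOn c P = ∀ (i : Fin k-1) → c (edge (inject₁ i)) ≢ c (edge (suc i))
  where open Path P

colorClass : ∀ {m} → (Fin m → Bool) → Bool → Subset m
colorClass c b = tabulate (λ e → does (c e Bool.≟ b))

{-# OPTIONS --safe #-}
-- Give an edge the sign +1 or −1 according to its color.  The discrepancy of the
-- incoming edges at v is the absolute value of the signed number of edges with
-- head v, which can be summed path by path.  Along an AD path with alternating
-- colors the two edges at an inner visit of v cancel, so only visits of v as an
-- incoming endpoint contribute.  A path whose two ends are both incoming has even
-- length, hence end edges of opposite colors; so even if both ends are v, a path
-- contributes at most 1 in absolute value, and at most one path contributes.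
-- Outgoing edges are the incoming edges of the reversed orientation.
module Submission where

open import Data.Bool using (Bool; true; false; not; _∧_; _∨_; _xor_; if_then_else_)
import Data.Bool.Properties as Bool
open import Data.Fin using (Fin; zero; suc; inject₁; fromℕ; _≟_)
open import Data.Fin.Subset using (Subset; ∁; _∪_; _∩_; ⊤; ⊥)
open import Data.Fin.Subset.Properties using (_∈?_; p∪∁p≡⊤; ∩-inverseʳ)
open import Data.Integer as ℤ using (ℤ; _+_; _⊖_; ∣_∣; 0ℤ; 1ℤ; -1ℤ)
import Data.Integer.Properties as ℤ
import Data.Integer.Tactic.RingSolver as ℤ-Solver
open import Data.List using (List; []; _∷_; _++_; map; concat; filter; length; tabulate; allFin)
open import Data.List.Membership.Propositional using (_∈_)
open import Data.List.Membership.Propositional.Properties using (∈-tabulate⁺; ∈-tabulate⁻; ∈-concat⁺′; ∈-allFin)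
open import Data.List.Membership.Propositional.Properties.WithK using (unique∧set⇒bag)
open import Data.List.Properties using (map-tabulate; filter-≐)
open import Data.List.Relation.Binary.BagAndSetEquality using (∼bag⇒↭)
open import Data.List.Relation.Binary.Permutation.Propositional as ↭ using (_↭_)
import Data.List.Relation.Unary.All.Properties as All
import Data.List.Relation.Unary.AllPairs.Properties as AllPairs
open import Data.List.Relation.Unary.Unique.Propositional using (Unique)
import Data.List.Relation.Unary.Unique.Propositional.Properties as Unique
open import Data.Nat as ℕ using (ℕ; zero; suc; _≤_; ∣_-_∣; z≤n)
import Data.Nat.Properties as ℕ
open import Data.Product using (_×_; _,_; proj₁; proj₂)
open import Data.Sum as Sum using (_⊎_; inj₁; inj₂)
open import Data.Vec using (lookup; _∷_)
import Data.Vec.Properties as Vec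
open import Function using (_∘_; id; mk⇔)
open import Relation.Binary.PropositionalEquality using (_≡_; _≢_; refl; sym; trans; cong; cong₂; subst; module ≡-Reasoning)
open import Relation.Nullary using (¬_; Dec; does; contradiction; _×-dec_)
open import Relation.Nullary.Decidable using (dec-true; dec-false)
open import Relation.Unary using (Pred; Decidable)

open import Defs

-- Finite sums and counting

Σ : ∀ {a} {A : Set a} → (A → ℤ) → List A → ℤ
Σ f []       = 0ℤ
Σ f (x ∷ xs) = f x + Σ f xs

indicator : ∀ {p} {P : Set p} → Dec P → ℕ
indicator P? = if does P? then 1 else 0

module _ {a} {A : Set a} where

  Σ-cong : {f g : A → ℤ} → (∀ x → f x ≡ g x) → ∀ xs → Σ f xs ≡ Σ g xs
  Σ-cong f≗g []       = refl
  Σ-cong f≗g (x ∷ xs) = cong₂ _+_ (f≗g x) (Σ-cong f≗g xs)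

  Σ-++ : (f : A → ℤ) (xs ys : List A) → Σ f (xs ++ ys) ≡ Σ f xs + Σ f ys
  Σ-++ f []       ys = sym (ℤ.+-identityˡ _)
  Σ-++ f (x ∷ xs) ys = trans (cong (f x +_) (Σ-++ f xs ys)) (sym (ℤ.+-assoc (f x) _ _))

  Σ-concat-map : ∀ {b} {B : Set b} (f : A → ℤ) (g : B → List A) (xs : List B) →
                 Σ f (concat (map g xs)) ≡ Σ (Σ f ∘ g) xs
  Σ-concat-map f g []       = refl
  Σ-concat-map f g (x ∷ xs) =
    trans (Σ-++ f (g x) _) (cong (Σ f (g x) +_) (Σ-concat-map f g xs))

  Σ-↭ : (f : A → ℤ) {xs ys : List A} → xs ↭ ys → Σ f xs ≡ Σ f ys
  Σ-↭ f ↭.refl          = refl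
  Σ-↭ f (↭.prep x p)    = cong (f x +_) (Σ-↭ f p)
  Σ-↭ f (↭.swap {xs} {ys} x y p) = begin
    f x + (f y + Σ f xs)  ≡⟨ cong (λ s → f x + (f y + s)) (Σ-↭ f p) ⟩
    f x + (f y + Σ f ys)  ≡⟨ x+[y+z]≡y+[x+z] (f x) (f y) _ ⟩
    f y + (f x + Σ f ys)  ∎
    where
    open ≡-Reasoning
    x+[y+z]≡y+[x+z] : ∀ i j k → i + (j + k) ≡ j + (i + k)
    x+[y+z]≡y+[x+z] = ℤ-Solver.solve-∀
  Σ-↭ f (↭.trans p q)   = trans (Σ-↭ f p) (Σ-↭ f q)

  length-filter-∷ : ∀ {p} {P : Pred A p} (P? : Decidable P) x xs →
                    length (filter P? (x ∷ xs)) ≡ indicator (P? x) ℕ.+ length (filter P? xs)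
  length-filter-∷ P? x xs with does (P? x)
  ... | true  = refl
  ... | false = refl

  -- The triangle inequality, term by term. Applied to paths, it turns a bound for each single path
  -- into the number of paths with an incoming endpoint at a vertex, which the decomposition
  -- controls.
  ∣Σ∣≤length-filter : ∀ {p} {P : Pred A p} (P? : Decidable P) (f : A → ℤ) →
                      (∀ x → ∣ f x ∣ ≤ indicator (P? x)) →
                      ∀ xs → ∣ Σ f xs ∣ ≤ length (filter P? xs)
  ∣Σ∣≤length-filter P? f f≤P []       = z≤n
  ∣Σ∣≤length-filter P? f f≤P (x ∷ xs) = begin
    ∣ f x + Σ f xs ∣                            ≤⟨ ℤ.∣i+j∣≤∣i∣+∣j∣ (f x) _ ⟩
    ∣ f x ∣ ℕ.+ ∣ Σ f xs ∣                      ≤⟨ ℕ.+-mono-≤ (f≤P x) (∣Σ∣≤length-filter P? f f≤P xs) ⟩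
    indicator (P? x) ℕ.+ length (filter P? xs)  ≡⟨ length-filter-∷ P? x xs ⟨
    length (filter P? (x ∷ xs))                 ∎
    where open ℕ.≤-Reasoning

  length-filter-⊖ : ∀ {p q} {P : Pred A p} {Q : Pred A q} (P? : Decidable P) (Q? : Decidable Q) →
                    ∀ xs → length (filter P? xs) ⊖ length (filter Q? xs)
                         ≡ Σ (λ x → indicator (P? x) ⊖ indicator (Q? x)) xs
  length-filter-⊖ P? Q? []       = refl
  length-filter-⊖ P? Q? (x ∷ xs) = begin
    length (filter P? (x ∷ xs)) ⊖ length (filter Q? (x ∷ xs))
      ≡⟨ cong₂ _⊖_ (length-filter-∷ P? x xs) (length-filter-∷ Q? x xs) ⟩
    (p ℕ.+ length (filter P? xs)) ⊖ (q ℕ.+ length (filter Q? xs))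
      ≡⟨ +-⊖-+ p q _ _ ⟩
    (p ⊖ q) + (length (filter P? xs) ⊖ length (filter Q? xs))
      ≡⟨ cong ((p ⊖ q) +_) (length-filter-⊖ P? Q? xs) ⟩
    (p ⊖ q) + Σ (λ x → indicator (P? x) ⊖ indicator (Q? x)) xs
      ∎
    where
    open ≡-Reasoning
    p q : ℕ
    p = indicator (P? x)
    q = indicator (Q? x)

    +-⊖-+ : ∀ k l m n → (k ℕ.+ m) ⊖ (l ℕ.+ n) ≡ (k ⊖ l) + (m ⊖ n)
    +-⊖-+ k l m n
      -- Replacing `_⊖_` by integer subtraction of casts leaves a ring identity.
      rewrite sym (ℤ.m-n≡m⊖n (k ℕ.+ m) (l ℕ.+ n)) | sym (ℤ.m-n≡m⊖n k l) | sym (ℤ.m-n≡m⊖n m n)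
            | ℤ.pos-+ k m | ℤ.pos-+ l n = lemma (ℤ.+ k) (ℤ.+ l) (ℤ.+ m) (ℤ.+ n)
      where
      lemma : ∀ i j k l → (i + k) ℤ.- (j + l) ≡ (i ℤ.- j) + (k ℤ.- l)
      lemma = ℤ-Solver.solve-∀

∣m-n∣≡∣m⊖n∣ : ∀ m n → ∣ m - n ∣ ≡ ∣ m ⊖ n ∣
∣m-n∣≡∣m⊖n∣ zero    zero    = refl
∣m-n∣≡∣m⊖n∣ zero    (suc n) = refl
∣m-n∣≡∣m⊖n∣ (suc m) zero    = refl
∣m-n∣≡∣m⊖n∣ (suc m) (suc n) = trans (∣m-n∣≡∣m⊖n∣ m n) (cong ∣_∣ (sym (ℤ.[1+m]⊖[1+n]≡m⊖n m n)))

-- Color classes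

does-∈? : ∀ {n} (i : Fin n) (p : Subset n) → does (i ∈? p) ≡ lookup p i
does-∈? zero    (true  ∷ p) = refl
does-∈? zero    (false ∷ p) = refl
does-∈? (suc i) (_     ∷ p) = does-∈? i p

module _ {m} (c : Fin m → Bool) where

  does-∈?-colorClass : ∀ b e → does (e ∈? colorClass c b) ≡ does (c e Bool.≟ b)
  does-∈?-colorClass b e = trans (does-∈? e (colorClass c b)) (Vec.lookup∘tabulate _ e)

  -- There are only two colors, so the complement laws then give both halves of the partition.
  colorClass-false : colorClass c false ≡ ∁ (colorClass c true)
  colorClass-false = trans (Vec.tabulate-cong (λ e → complement (c e))) (Vec.tabulate-∘ not _)
    where
    complement : ∀ b → does (b Bool.≟ false) ≡ not (does (b Bool.≟ true))
    complement true  = refl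
    complement false = refl

  colorClass-∪ : colorClass c true ∪ colorClass c false ≡ ⊤
  colorClass-∪ = trans (cong (colorClass c true ∪_) colorClass-false) (p∪∁p≡⊤ _)

  colorClass-∩ : colorClass c true ∩ colorClass c false ≡ ⊥
  colorClass-∩ = trans (cong (colorClass c true ∩_) colorClass-false) (∩-inverseʳ _)

-- Signed contributions

signedIf : Bool → Bool → ℤ
signedIf p b = if p then (if b then 1ℤ else -1ℤ) else 0ℤ

signedIf-cancel : ∀ p {b b′} → b ≢ b′ → signedIf p b + signedIf p b′ ≡ 0ℤ
signedIf-cancel false                  b≢b′ = refl
signedIf-cancel true  {true}  {true}  b≢b′ = contradiction refl b≢b′
signedIf-cancel true  {true}  {false} b≢b′ = refl
signedIf-cancel true  {false} {true}  b≢b′ = refl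
signedIf-cancel true  {false} {false} b≢b′ = contradiction refl b≢b′

∣signedIf∣≤1 : ∀ b → ∣ signedIf true b ∣ ≤ 1
∣signedIf∣≤1 true  = ℕ.≤-refl
∣signedIf∣≤1 false = ℕ.≤-refl

-- The critical case has both conditions true, as for a path with both ends incoming at one vertex:
-- opposite colors cancel there. The bound is a Boolean disjunction because the indicator of
-- `incomingEndpoint?` computes to that form.
∣signedIf+signedIf∣≤∨ : ∀ p q {b b′} → (p ≡ true → q ≡ true → b ≢ b′) →
                        ∣ signedIf p b + signedIf q b′ ∣ ≤ (if p ∨ q then 1 else 0)
∣signedIf+signedIf∣≤∨ true  true  b≢b′
  rewrite signedIf-cancel true (b≢b′ refl refl) = z≤n
∣signedIf+signedIf∣≤∨ true  false {b} _
  rewrite ℤ.+-identityʳ (signedIf true b) = ∣signedIf∣≤1 b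
∣signedIf+signedIf∣≤∨ false true  {b′ = b′} _
  rewrite ℤ.+-identityˡ (signedIf true b′) = ∣signedIf∣≤1 b′
∣signedIf+signedIf∣≤∨ false false _ = z≤n

-- Direction of an edge relative to its ends.

module _ {G : Graph} (μ : Orientation G) where
  open Graph G
  open Orientation μ

  -- Looplessness enters here; it makes `Towards` and `Away` mutually exclusive at a vertex.
  head≢tail : ∀ e → head e ≢ tail e
  head≢tail e h≡t with orients e
  ... | inj₁ p = loopless e (trans (cong proj₁ p) (trans (sym h≡t) (sym (cong proj₂ p))))
  ... | inj₂ p = loopless e (trans (cong proj₁ p) (trans h≡t (sym (cong proj₂ p))))

  joins-orientation : ∀ {e u v} → Joins e u v →
                      (Towards e u × Away e v) ⊎ (Away e u × Towards e v)
  joins-orientation {e} e:uv with orients e | e:uv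
  ... | inj₁ p | inj₁ q = inj₂ (cong proj₁ (trans (sym p) q) , cong proj₂ (trans (sym p) q))
  ... | inj₁ p | inj₂ q = inj₁ (cong proj₂ (trans (sym p) q) , cong proj₁ (trans (sym p) q))
  ... | inj₂ p | inj₁ q = inj₁ (cong proj₁ (trans (sym p) q) , cong proj₂ (trans (sym p) q))
  ... | inj₂ p | inj₂ q = inj₂ (cong proj₂ (trans (sym p) q) , cong proj₁ (trans (sym p) q))

  away⇒¬towards : ∀ {e v} → Away e v → ¬ Towards e v
  away⇒¬towards {e} t≡v h≡v = head≢tail e (trans h≡v (sym t≡v))

  SameDirection : E → E → V → Set
  SameDirection e e′ v = (Towards e v × Towards e′ v) ⊎ (Away e v × Away e′ v)

  sameDirection⇒does : ∀ {e e′ v} → SameDirection e e′ v →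
                       does (towards? e v) ≡ does (towards? e′ v)
  sameDirection⇒does {e} {e′} {v} (inj₁ (h , h′)) =
    trans (dec-true (towards? e v) h) (sym (dec-true (towards? e′ v) h′))
  sameDirection⇒does {e} {e′} {v} (inj₂ (t , t′)) =
    trans (dec-false (towards? e v) (away⇒¬towards t))
          (sym (dec-false (towards? e′ v) (away⇒¬towards t′)))

  -- Parity along an alternating walk.

  module _ (c : E → Bool) where

    -- Constant along an alternating AD path when read at the vertex before each
    -- edge, and flipped when read at the vertex after it.
    phase : V → E → Bool
    phase u e = does (towards? e u) xor c e

    -- Exactly one end of `e` is its head, so the direction bit flips while the color stays.
    phase-across-edge : ∀ {e u u′} → Joins e u u′ → phase u e ≡ not (phase u′ e)
    phase-across-edge {e} {u} {u′} e:uu′ with joins-orientation e:uu′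
    ... | inj₁ (h , t)
      rewrite dec-true (towards? e u) h | dec-false (towards? e u′) (away⇒¬towards t) = refl
    ... | inj₂ (t , h)
      rewrite dec-true (towards? e u′) h | dec-false (towards? e u) (away⇒¬towards t) =
      sym (Bool.not-involutive _)

    -- Here the direction bit stays and the color flips.
    phase-across-vertex : ∀ {e e′ u} → SameDirection e e′ u → c e ≢ c e′ →
                          phase u e ≡ not (phase u e′)
    phase-across-vertex {e} {e′} {u} same c≢c′ = begin
      does (towards? e u) xor c e          ≡⟨ cong₂ _xor_ (sameDirection⇒does same) (Bool.¬-not c≢c′) ⟩
      does (towards? e′ u) xor not (c e′)  ≡⟨ Bool.not-distribʳ-xor (does (towards? e′ u)) (c e′) ⟨
      not (phase u e′)                     ∎
      where open ≡-Reasoning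

    -- The `n + 1` edges and `n` inner vertices each contribute one negation, an odd number in all.
    -- This takes the place of a parity argument on the length. Bare sequences instead of a `Path`
    -- let the induction drop the first edge by composing with `suc`.
    phase-walk : ∀ n (x : Fin (suc (suc n)) → V) (e : Fin (suc n) → E) →
      (∀ i → Joins (e i) (x (inject₁ i)) (x (suc i))) →
      (∀ i → SameDirection (e (inject₁ i)) (e (suc i)) (x (suc (inject₁ i)))) →
      (∀ i → c (e (inject₁ i)) ≢ c (e (suc i))) →
      phase (x zero) (e zero) ≡ not (phase (x (fromℕ (suc n))) (e (fromℕ n)))
    phase-walk zero    x e joins same alt = phase-across-edge (joins zero)
    phase-walk (suc n) x e joins same alt = begin
      phase (x zero) (e zero)                    ≡⟨ phase-across-edge (joins zero) ⟩
      not (phase (x (suc zero)) (e zero))        ≡⟨ cong not (phase-across-vertex (same zero) (alt zero)) ⟩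
      not (not (phase (x (suc zero)) (e (suc zero))))
        ≡⟨ Bool.not-involutive _ ⟩
      phase (x (suc zero)) (e (suc zero))
        ≡⟨ phase-walk n (x ∘ suc) (e ∘ suc) (joins ∘ suc) (same ∘ suc) (alt ∘ suc) ⟩
      not (phase (x (fromℕ (suc (suc n)))) (e (fromℕ (suc n)))) ∎
      where open ≡-Reasoning

    -- Signed weight of a path at a fixed vertex.

    module _ (v : V) where

      weight : E → ℤ
      weight e = signedIf (does (towards? e v)) (c e)

      -- The share of `weight e` credited to a visit of the walk at `u`. Its condition is the
      -- Boolean form of one disjunct of `IncomingEndpoint`, so the shares at the two ends of a path
      -- match the endpoint test by computation.
      weightAt : V → E → ℤ
      weightAt u e = signedIf (does (u ≟ v) ∧ does (towards? e u)) (c e)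

      weightAt-towards : ∀ {e u} → Towards e u → weightAt u e ≡ weight e
      -- Matching makes `u` the head of `e`, so the test `u ≟ v` becomes the test `towards? e v` of
      -- `weight`.
      weightAt-towards {e} refl
        rewrite dec-true (towards? e (head e)) refl
              | Bool.∧-identityʳ (does (head e ≟ v)) = refl

      weightAt-away : ∀ {e u} → Away e u → weightAt u e ≡ 0ℤ
      weightAt-away {e} {u} t
        rewrite dec-false (towards? e u) (away⇒¬towards t)
              | Bool.∧-zeroʳ (does (u ≟ v)) = refl

      weight-split : ∀ {e u u′} → Joins e u u′ → weight e ≡ weightAt u e + weightAt u′ e
      weight-split {e} e:uu′ with joins-orientation e:uu′
      ... | inj₁ (h , t) =
        sym (trans (cong₂ _+_ (weightAt-towards h) (weightAt-away t)) (ℤ.+-identityʳ _))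
      ... | inj₂ (t , h) =
        sym (trans (cong₂ _+_ (weightAt-away t) (weightAt-towards h)) (ℤ.+-identityˡ _))

      weightAt-cancel : ∀ {e e′ u} → SameDirection e e′ u → c e ≢ c e′ →
                        weightAt u e + weightAt u e′ ≡ 0ℤ
      weightAt-cancel {e} {e′} {u} same c≢c′
        rewrite sameDirection⇒does same =
        signedIf-cancel (does (u ≟ v) ∧ does (towards? e′ u)) c≢c′

      -- Telescoping: every edge weight splits into shares at its two ends, and the two shares
      -- meeting at an inner visit cancel.
      Σ-weight-walk : ∀ n (x : Fin (suc (suc n)) → V) (e : Fin (suc n) → E) →
        (∀ i → Joins (e i) (x (inject₁ i)) (x (suc i))) →
        (∀ i → SameDirection (e (inject₁ i)) (e (suc i)) (x (suc (inject₁ i)))) →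
        (∀ i → c (e (inject₁ i)) ≢ c (e (suc i))) →
        Σ weight (tabulate e)
          ≡ weightAt (x zero) (e zero) + weightAt (x (fromℕ (suc n))) (e (fromℕ n))
      Σ-weight-walk zero    x e joins same alt =
        trans (ℤ.+-identityʳ _) (weight-split (joins zero))
      Σ-weight-walk (suc n) x e joins same alt = begin
        weight (e zero) + Σ weight (tabulate (e ∘ suc))
          ≡⟨ cong₂ _+_ (weight-split (joins zero))
               (Σ-weight-walk n (x ∘ suc) (e ∘ suc) (joins ∘ suc) (same ∘ suc) (alt ∘ suc)) ⟩
        (first + inner) + (inner′ + last)
          ≡⟨ regroup first inner inner′ last ⟩
        (first + last) + (inner + inner′)
          ≡⟨ cong ((first + last) +_) (weightAt-cancel (same zero) (alt zero)) ⟩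
        (first + last) + 0ℤ
          ≡⟨ ℤ.+-identityʳ _ ⟩
        first + last
          ∎
        where
        open ≡-Reasoning
        first inner inner′ last : ℤ
        first  = weightAt (x zero) (e zero)
        inner  = weightAt (x (suc zero)) (e zero)
        inner′ = weightAt (x (suc zero)) (e (suc zero))
        last   = weightAt (x (fromℕ (suc (suc n)))) (e (fromℕ (suc n)))

        regroup : ∀ i j k l → (i + j) + (k + l) ≡ (i + l) + (j + k)
        regroup = ℤ-Solver.solve-∀

      ∣Σ-weight-path∣≤ : (P : Path G) → IsAD μ P → AlternatesOn c P →
        ∣ Σ weight (tabulate (Path.edge P)) ∣ ≤ indicator (incomingEndpoint? μ v P)
      ∣Σ-weight-path∣≤ P ad alt = begin
        ∣ Σ weight (tabulate edge) ∣
          ≡⟨ cong ∣_∣ (Σ-weight-walk k-1 vertex edge joins ad alt) ⟩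
        ∣ weightAt firstVertex firstEdge + weightAt lastVertex lastEdge ∣
          ≤⟨ ∣signedIf+signedIf∣≤∨ (does (firstVertex ≟ v) ∧ does (towards? firstEdge firstVertex))
               (does (lastVertex ≟ v) ∧ does (towards? lastEdge lastVertex)) opposite ⟩
        indicator (incomingEndpoint? μ v P)
          ∎
        where
        open Path P
        open ℕ.≤-Reasoning

        ∧-true : ∀ p {q} → p ∧ q ≡ true → q ≡ true
        ∧-true true q = q

        opposite : does (firstVertex ≟ v) ∧ does (towards? firstEdge firstVertex) ≡ true →
                   does (lastVertex ≟ v) ∧ does (towards? lastEdge lastVertex) ≡ true →
                   c firstEdge ≢ c lastEdge
        -- Both ends are incoming, so equal end colors would give equal phases, whereas `phase-walk`
        -- makes them negations of each other.
        opposite p q c≡c′ = Bool.not-¬ {phase firstVertex firstEdge} same-phase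
          (phase-walk k-1 vertex edge joins ad alt)
          where
          same-phase : phase firstVertex firstEdge ≡ phase lastVertex lastEdge
          same-phase = cong₂ _xor_ (trans (∧-true (does (firstVertex ≟ v)) p)
                                          (sym (∧-true (does (lastVertex ≟ v)) q))) c≡c′

      weight-indicators : ∀ e →
        indicator ((e ∈? colorClass c true) ×-dec towards? e v)
          ⊖ indicator ((e ∈? colorClass c false) ×-dec towards? e v)
        ≡ weight e
      weight-indicators e
        rewrite does-∈?-colorClass c true e | does-∈?-colorClass c false e
        with c e | does (towards? e v)
      ... | true  | true  = refl
      ... | true  | false = refl
      ... | false | true  = refl
      ... | false | false = refl

      inDegree-⊖ : inDegree μ (colorClass c true) v ⊖ inDegree μ (colorClass c false) v
                   ≡ Σ weight (allFin #E)
      inDegree-⊖ = trans (length-filter-⊖ _ _ (allFin #E)) (Σ-cong weight-indicators (allFin #E))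

  -- Summation over the paths of a decomposition.

  module _ {κ} (D : ADPathsDecomposition μ κ) where
    open ADPathsDecomposition D

    pathEdges : Fin #paths → List E
    pathEdges a = tabulate (Path.edge (path a))

    -- Two duplicate-free lists with the same members are permutations of each other. Repetition is
    -- excluded within a path by `distinct` and between paths by `disjoint`; `covers` gives
    -- membership.
    allFin↭pathEdges : allFin #E ↭ concat (map pathEdges (allFin #paths))
    -- `allFin` is `tabulate id`, so the list of paths takes the `tabulate` form used by the
    -- uniqueness and membership lemmas.
    allFin↭pathEdges rewrite map-tabulate id pathEdges =
      ∼bag⇒↭ (unique∧set⇒bag (Unique.allFin⁺ #E) unique
        (λ {e} → mk⇔ (λ _ → member e) (λ _ → ∈-allFin e)))
      where
      contains : ∀ a {e} → e ∈ pathEdges a → Path.Contains (path a) e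
      contains a e∈a with i , e≡ ← ∈-tabulate⁻ e∈a = i , sym e≡

      unique : Unique (concat (tabulate pathEdges))
      unique = Unique.concat⁺
        (All.tabulate⁺ (λ a → Unique.tabulate⁺ (Path.distinct (path a))))
        (AllPairs.tabulate⁺ (λ {a} {b} a≢b {e} (e∈a , e∈b) →
          a≢b (disjoint a b e (contains a e∈a) (contains b e∈b))))

      member : ∀ e → e ∈ concat (tabulate pathEdges)
      member e with a , i , refl ← covers e = 
        ∈-concat⁺′ (∈-tabulate⁺ {f = Path.edge (path a)} i) (∈-tabulate⁺ {f = pathEdges} a)

    inDegree-discrepancy : (c : E → Bool) → (∀ a → AlternatesOn c (path a)) → ∀ v →
      ∣ inDegree μ (colorClass c true) v - inDegree μ (colorClass c false) v ∣ ≤ κ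
    inDegree-discrepancy c alt v = begin
      ∣ d₁ - d₂ ∣                                          ≡⟨ ∣m-n∣≡∣m⊖n∣ d₁ d₂ ⟩
      ∣ d₁ ⊖ d₂ ∣                                          ≡⟨ cong ∣_∣ (inDegree-⊖ c v) ⟩
      ∣ Σ w (allFin #E) ∣                                  ≡⟨ cong ∣_∣ (Σ-↭ w allFin↭pathEdges) ⟩
      ∣ Σ w (concat (map pathEdges (allFin #paths))) ∣     ≡⟨ cong ∣_∣ (Σ-concat-map w pathEdges (allFin #paths)) ⟩
      ∣ Σ (Σ w ∘ pathEdges) (allFin #paths) ∣
        ≤⟨ ∣Σ∣≤length-filter (λ a → incomingEndpoint? μ v (path a)) (Σ w ∘ pathEdges)
             (λ a → ∣Σ-weight-path∣≤ c v (path a) (isAD a) (alt a)) (allFin #paths) ⟩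
      count (λ a → incomingEndpoint? μ v (path a))         ≤⟨ incoming≤κ v ⟩
      κ                                                    ∎
      where
      open ℕ.≤-Reasoning
      d₁ d₂ : ℕ
      d₁ = inDegree μ (colorClass c true) v
      d₂ = inDegree μ (colorClass c false) v
      w : E → ℤ
      w = weight c v

-- Reversal of the orientation

reverse : ∀ {G} → Orientation G → Orientation G
reverse μ = record
  { tail    = Orientation.head μ
  ; head    = Orientation.tail μ
  ; orients = Sum.swap ∘ Orientation.orients μ
  }

module _ {G : Graph} (μ : Orientation G) where
  open Graph G
  open Orientation μ

  ¬towards⇒away : ∀ {e u v} → Joins e u v → ¬ Towards e u → Away e u
  ¬towards⇒away e:uv ¬h with joins-orientation μ e:uv
  ... | inj₁ (h , _) = contradiction h ¬h
  ... | inj₂ (t , _) = t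

  -- Incoming for `reverse μ` asks for `Away`, outgoing for `μ` asks for the negation of `Towards`.
  -- These agree because the end edge is incident to the end vertex.
  count-incoming-reverse : ∀ {n} (path : Fin n → Path G) v →
    count (λ a → incomingEndpoint? (reverse μ) v (path a)) ≡ count (λ a → outgoingEndpoint? μ v (path a))
  count-incoming-reverse {n} path v = cong length (filter-≐ _ _
    ( (λ {a} → Sum.map (λ (x≡v , t) → x≡v , away⇒¬towards μ t) (λ (x≡v , t) → x≡v , away⇒¬towards μ t))
    , (λ {a} → let open Path (path a) in
         Sum.map (λ (x≡v , ¬h) → x≡v , ¬towards⇒away (joins zero) ¬h)
                 -- The last vertex is the second end of the last edge, hence the swap.
                 (λ (x≡v , ¬h) → x≡v , ¬towards⇒away (Sum.swap (joins (fromℕ k-1))) ¬h)))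
    (allFin n))

reverseDecomposition : ∀ {G} {μ : Orientation G} {κ} →
                       ADPathsDecomposition μ κ → ADPathsDecomposition (reverse μ) κ
reverseDecomposition {μ = μ} {κ} D = record
  { #paths     = #paths
  ; path       = path
  ; isAD       = λ a i → Sum.swap (isAD a i)
  ; covers     = covers
  ; disjoint   = disjoint
  ; incoming≤κ = λ v → subst (_≤ κ) (sym (count-incoming-reverse μ path v)) (outgoing≤κ v)
  -- Reversing twice restores `head` by computation, and the incoming test reads nothing else of the
  -- orientation.
  ; outgoing≤κ = λ v → subst (_≤ κ) (count-incoming-reverse (reverse μ) path v) (incoming≤κ v)
  }
  where open ADPathsDecomposition D

theorem4p5 : (G : Graph) (μ : Orientation G) (D : ADPathsDecomposition μ 1)
    (c : Graph.E G → Bool) →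
    (∀ a → AlternatesOn c (ADPathsDecomposition.path D a)) →
    IsOrientedDegreeSplitting μ 1 (colorClass c true) (colorClass c false)
theorem4p5 G μ D c alt = record
  { exhaustive     = colorClass-∪ c
  ; disjoint       = colorClass-∩ c
  ; inDiscrepancy  = inDegree-discrepancy μ D c alt
  -- `inDegree` for `reverse μ` computes to `outDegree` for `μ`, and the paths are unchanged, so
  -- `alt` applies as it stands.
  ; outDiscrepancy = inDegree-discrepancy (reverse μ) (reverseDecomposition D) c alt
  }
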